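{- If $n=2^k$, where $k\ge 1$ is an integer, then $\rho_e^o(Q_n)=2^{n-1}$.
   Context: All graphs are finite and simple. A set $B\subseteq E(G)$ is an edge open packing set (EOP set) of $G$ if for any two distinct edges $e_1,e_2\in B$ there is no edge $e\in E(G)\setminus\{e_1,e_2\}$ joining an endvertex of $e_1$ to an endvertex of $e_2$ (that is, no edge $e$ such that $e_1,e,e_2$ form a path with middle edge $e$ or a triangle). Edges of $B$ may share an endvertex. The maximum cardinality of an EOP set is the EOP number $\rho_e^o(G)$. $Q_n$ is the $n$-dimensional hypercube: $Q_1=K_2$ and $Q_n=Q_{n-1}\,\square\,K_2$ for $n\ge 2$, where in the Cartesian product $G\,\square\,H$ (on vertex set $V(G)\times V(H)$) two vertices are adjacent if they are adjacent in one coordinate and equal in the other. -}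

module Defs where

open import Level using (0ℓ)
open import Data.Nat using (ℕ; suc; _*_; _≤_; NonZero)
open import Data.Nat.Properties using (≤-antisym)
open import Data.Fin using (Fin)
open import Data.Fin.Properties using (_≟_; *↔×)
open import Data.List using (List; length)
import Data.List.Membership.Setoid as Membership
import Data.List.Relation.Unary.Unique.Setoid as UniqueS
open import Data.Product using (_×_; _,_; ∃-syntax)
open import Data.Product.Function.NonDependent.Propositional using (_×-↔_)
open import Data.Sum using (_⊎_; inj₁; inj₂)
open import Function.Bundles using (_↔_)
open import Function.Construct.Composition using (_↔-∘_)
open import Function.Construct.Identity using (↔-id)
open import Function.Construct.Symmetry using (↔-sym)
open import Function.Properties.Inverse using (Inverse⇒Injection)
open import Relation.Binary.Bundles using (Setoid)
open import Relation.Binary.Definitions using (Decidable; DecidableEquality; Symmetric)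
open import Relation.Binary.PropositionalEquality using (_≡_; _≢_; refl; sym; trans; ≢-sym)
open import Relation.Nullary using (¬_)
open import Relation.Nullary.Decidable using (¬?; _×-dec_; _⊎-dec_; via-injection)

-- Finite simple graphs.  Decidability of adjacency is automatic classically.
record Graph : Set₁ where
  infix 4 _~_
  field
    Vertex : Set
    order  : ℕ
    finite : Vertex ↔ Fin order
    _~_    : Vertex → Vertex → Set
    _~?_   : Decidable _~_
    ~-sym  : Symmetric _~_
    ~-irr  : ∀ {v} → ¬ (v ~ v)

  _≟ᵛ_ : DecidableEquality Vertex
  _≟ᵛ_ = via-injection (Inverse⇒Injection finite) _≟_

complete : ℕ → Graph
complete n = record
  { Vertex = Fin n
  ; order  = n
  ; finite = ↔-id (Fin n)
  ; _~_    = _≢_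
  ; _~?_   = λ i j → ¬? (i ≟ j)
  ; ~-sym  = ≢-sym
  ; ~-irr  = λ v≢v → v≢v refl
  }

infixl 7 _□_

_□_ : Graph → Graph → Graph
G □ H = record
  { Vertex = G.Vertex × H.Vertex
  ; order  = G.order * H.order
  ; finite = ↔-sym *↔× ↔-∘ (G.finite ×-↔ H.finite)
  ; _~_    = λ (g , h) (g′ , h′) → (g G.~ g′ × h ≡ h′) ⊎ (g ≡ g′ × h H.~ h′)
  ; _~?_   = λ (g , h) (g′ , h′) →
               ((g G.~? g′) ×-dec (h H.≟ᵛ h′)) ⊎-dec ((g G.≟ᵛ g′) ×-dec (h H.~? h′))
  ; ~-sym  = λ { (inj₁ (a , p)) → inj₁ (G.~-sym a , sym p)
               ; (inj₂ (p , a)) → inj₂ (sym p , H.~-sym a) }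
  ; ~-irr  = λ { (inj₁ (a , _)) → G.~-irr a
               ; (inj₂ (_ , a)) → H.~-irr a }
  }
  where
  module G = Graph G
  module H = Graph H

Q : (n : ℕ) .{{_ : NonZero n}} → Graph
Q 1             = complete 2
Q (suc (suc n)) = Q (suc n) □ complete 2

module _ (G : Graph) where
  open Graph G

  -- An edge with an arbitrarily chosen orientation; edges are compared with
  -- _≈ᵉ_, which ignores the orientation and the proof of adjacency.
  record Edge : Set where
    constructor edge
    field
      end₁ end₂ : Vertex
      adjacent  : end₁ ~ end₂

module _ {G : Graph} where
  open Graph G
  open Edge

  infix 4 _≈ᵉ_ _endOf_

  _≈ᵉ_ : Edge G → Edge G → Set
  e ≈ᵉ f = (end₁ e ≡ end₁ f × end₂ e ≡ end₂ f) ⊎ (end₁ e ≡ end₂ f × end₂ e ≡ end₁ f)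

  _endOf_ : Vertex → Edge G → Set
  v endOf e = v ≡ end₁ e ⊎ v ≡ end₂ e

  Joins : Edge G → Edge G → Edge G → Set
  Joins e e₁ e₂ = (end₁ e endOf e₁ × end₂ e endOf e₂) ⊎ (end₂ e endOf e₁ × end₁ e endOf e₂)

module _ (G : Graph) where

  edgeSetoid : Setoid 0ℓ 0ℓ
  edgeSetoid = record
    { Carrier       = Edge G
    ; _≈_           = _≈ᵉ_
    ; isEquivalence = record
      { refl  = inj₁ (refl , refl)
      ; sym   = λ { (inj₁ (p , q)) → inj₁ (sym p , sym q)
                  ; (inj₂ (p , q)) → inj₂ (sym q , sym p) }
      ; trans = λ { (inj₁ (p , q)) (inj₁ (r , s)) → inj₁ (trans p r , trans q s)
                  ; (inj₁ (p , q)) (inj₂ (r , s)) → inj₂ (trans p r , trans q s)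
                  ; (inj₂ (p , q)) (inj₁ (r , s)) → inj₂ (trans p s , trans q r)
                  ; (inj₂ (p , q)) (inj₂ (r , s)) → inj₁ (trans p s , trans q r) }
      }
    }

  open Membership edgeSetoid using (_∈_)
  open UniqueS edgeSetoid using (Unique)

  -- A set of edges is a list without repetitions (up to _≈ᵉ_), so that its
  -- cardinality is the length of the list.
  record EdgeSet : Set where
    field
      edges  : List (Edge G)
      unique : Unique edges

  open EdgeSet

  ∣_∣ᵉ : EdgeSet → ℕ
  ∣ B ∣ᵉ = length (edges B)

  IsEOP : EdgeSet → Set
  IsEOP B = ∀ e₁ e₂ → e₁ ∈ edges B → e₂ ∈ edges B → ¬ (e₁ ≈ᵉ e₂) →
            ¬ (∃[ e ] (¬ (e ≈ᵉ e₁) × ¬ (e ≈ᵉ e₂) × Joins e e₁ e₂))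

  -- The EOP number as a functional relation: m is the maximum cardinality of
  -- an EOP set.
  IsEOPNumber : ℕ → Set
  IsEOPNumber m = (∃[ B ] (IsEOP B × ∣ B ∣ᵉ ≡ m)) × (∀ B → IsEOP B → ∣ B ∣ᵉ ≤ m)

  IsEOPNumber-unique : ∀ {m m′} → IsEOPNumber m → IsEOPNumber m′ → m ≡ m′
  IsEOPNumber-unique ((B , p , refl) , max) ((B′ , p′ , refl) , max′) =
    ≤-antisym (max′ B p) (max B′ p′)

{-# OPTIONS --safe #-}

-- Upper bound: the edges of an EOP set form an induced star forest, and
-- choosing a leaf on every edge gives an independent set of vertices.  In a
-- prism G □ K₂ an independent set meets each K₂-fibre at most once, so an EOP
-- set of the prism has at most |V(G)| edges.
--
-- Lower bound: label the 2ᵏ coordinates by the vectors (1, b), b ∈ 𝔽₂ᵏ, i.e. by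
-- the columns of the parity check matrix of the extended Hamming code.  A
-- vertex of odd weight has a syndrome (1, b), so flipping the coordinate b
-- yields its only neighbour in the code.  The edges joining the odd vertices to
-- the code are the full stars around codewords and form an EOP set.
module Submission where

open import Defs
open import Data.Bool using (Bool; true; false; not; _xor_)
open import Data.Bool.Properties using (not-involutive; not-¬; xor-assoc; xor-comm; xor-identityʳ)
open import Data.Fin using (Fin; zero; suc; opposite)
open import Data.Fin.Patterns using (0F; 1F)
open import Data.Fin.Properties using (_≟_; 2↔Bool; injective⇒≤)
open import Data.List using (length; lookup; tabulate)
open import Data.List.Properties using (length-tabulate)
open import Data.List.Membership.Propositional.Properties using (∈-lookup)
import Data.List.Membership.Setoid as Membership
import Data.List.Membership.Setoid.Properties as Membershipₚ
import Data.List.Relation.Unary.All as All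
open import Data.List.Relation.Unary.AllPairs using (_∷_)
open import Data.List.Relation.Unary.Any using (any?)
import Data.List.Relation.Unary.Unique.Setoid as UniqueS
open import Data.List.Relation.Unary.Unique.Setoid.Properties using (tabulate⁺)
open import Data.Nat using (ℕ; zero; suc; _+_; _*_; _^_; _∸_; _≤_; _≥_; NonZero)
open import Data.Nat.Properties using (*-comm; m^n≡0⇒m≡0; m*n≡1⇒m≡1)
open import Data.Product using (∃-syntax; _×_; _,_; proj₁; proj₂)
open import Data.Sum using (_⊎_; inj₁; inj₂; [_,_]′; swap)
open import Data.Vec using (Vec; []; _∷_; head; tail; zipWith; replicate)
open import Data.Vec.Properties using (zipWith-assoc; zipWith-comm; zipWith-identityʳ)
import Data.Vec.Recursive as Rec
open import Data.Vec.Recursive.Properties using (↔Vec)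
open import Function using (_∘_)
open import Function.Bundles using (_↔_; Injection; Inverse)
open import Function.Properties.Inverse using (Inverse⇒Injection; ↔-sym; ↔-trans)
open import Relation.Binary.Bundles using (Setoid)
open import Relation.Binary.PropositionalEquality
  using (_≡_; _≢_; refl; sym; trans; cong; cong₂; subst; module ≡-Reasoning)
open import Relation.Nullary using (¬_; Dec; yes; no; contradiction)
open import Relation.Nullary.Decidable using (¬?; _×-dec_; _⊎-dec_)

-- Repetition-free lists, and edges up to orientation

module _ {a ℓ} (S : Setoid a ℓ) where
  open Setoid S using (_≈_) renaming (sym to ≈-sym)
  open UniqueS S using (Unique)

  -- The size of an edge set is a list length, so counting by injections works on positions; this
  -- turns equality of edges back into equality of positions.
  lookup-injective : ∀ {xs} → Unique xs → ∀ i j → lookup xs i ≈ lookup xs j → i ≡ j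
  lookup-injective (_  ∷ _)  zero    zero    _ = refl
  lookup-injective (x∉ ∷ _)  zero    (suc j) p =
    contradiction p (All.lookup x∉ (∈-lookup j))
  lookup-injective (x∉ ∷ _)  (suc i) zero    p =
    contradiction (≈-sym p) (All.lookup x∉ (∈-lookup i))
  lookup-injective (_  ∷ xs) (suc i) (suc j) p = cong suc (lookup-injective xs i j p)

module _ {G : Graph} where
  open Graph G
  open Edge

  _≈ᵉ?_ : (e f : Edge G) → Dec (e ≈ᵉ f)
  e ≈ᵉ? f = ((end₁ e ≟ᵛ end₁ f) ×-dec (end₂ e ≟ᵛ end₂ f))
      ⊎-dec ((end₁ e ≟ᵛ end₂ f) ×-dec (end₂ e ≟ᵛ end₁ f))

  _endOf?_ : (v : Vertex) (e : Edge G) → Dec (v endOf e)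
  v endOf? e = (v ≟ᵛ end₁ e) ⊎-dec (v ≟ᵛ end₂ e)

  endOf-resp : ∀ {v} (e f : Edge G) → e ≈ᵉ f → v endOf e → v endOf f
  endOf-resp _ _ (inj₁ (refl , refl)) = λ v∈e → v∈e
  endOf-resp _ _ (inj₂ (refl , refl)) = swap

  both-ends⇒≈ᵉ : (e f : Edge G) → end₁ e endOf f → end₂ e endOf f → e ≈ᵉ f
  both-ends⇒≈ᵉ _            _ (inj₁ p)    (inj₂ q)    = inj₁ (p , q)
  both-ends⇒≈ᵉ _            _ (inj₂ p)    (inj₁ q)    = inj₂ (p , q)
  both-ends⇒≈ᵉ (edge _ _ a) _ (inj₁ refl) (inj₁ refl) = contradiction a ~-irr
  both-ends⇒≈ᵉ (edge _ _ a) _ (inj₂ refl) (inj₂ refl) = contradiction a ~-irr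

-- Leaves of an EOP set

module Leaves {G : Graph} (B : EdgeSet G) (eop : IsEOP G B) where
  open Graph G
  open Edge
  open EdgeSet B
  open Setoid (edgeSetoid G) using () renaming (sym to ≈ᵉ-sym; trans to ≈ᵉ-trans)
  open Membership (edgeSetoid G) using (_∈_; find; lose)

  record IsLeafOf (v : Vertex) (e : Edge G) : Set where
    constructor _,_
    field
      isEnd    : v endOf e
      onlyEdge : ∀ f → f ∈ edges → v endOf f → e ≈ᵉ f

  private
    SharesEnd₁ : Edge G → Edge G → Set
    SharesEnd₁ e f = ¬ (e ≈ᵉ f) × end₁ e endOf f

  -- If other edges `f` and `g` of the set met `e` at its first and second end, then `e` itself
  -- would join `f` to `g`. These two are distinct, since a common edge would contain both ends of
  -- `e` and so be `e`.
  leaf : ∀ e → e ∈ edges → ∃[ v ] IsLeafOf v e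
  leaf e e∈B with any? (λ f → ¬? (e ≈ᵉ? f) ×-dec (end₁ e endOf? f)) edges
  ... | no ¬shared = end₁ e , (inj₁ refl , unique-edge)
    where
    shares-resp : ∀ f g → f ≈ᵉ g → SharesEnd₁ e f → SharesEnd₁ e g
    shares-resp f g f≈g (e≉f , p) =
      (λ e≈g → e≉f (≈ᵉ-trans {e} {g} {f} e≈g (≈ᵉ-sym {f} {g} f≈g))) , endOf-resp f g f≈g p
    unique-edge : ∀ f → f ∈ edges → end₁ e endOf f → e ≈ᵉ f
    unique-edge f f∈B p with e ≈ᵉ? f
    ... | yes e≈f = e≈f
    ... | no  e≉f = contradiction
      (lose {P = SharesEnd₁ e} (λ {g} {h} → shares-resp g h) {f} f∈B (e≉f , p)) ¬shared
  ... | yes shared with f , f∈B , e≉f , p ← find shared = end₂ e , (inj₂ refl , unique-edge)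
    where
    unique-edge : ∀ g → g ∈ edges → end₂ e endOf g → e ≈ᵉ g
    unique-edge g g∈B q with e ≈ᵉ? g
    ... | yes e≈g = e≈g
    ... | no  e≉g = contradiction (e , e≉f , e≉g , inj₁ (p , q))
      (eop f g f∈B g∈B λ f≈g → e≉f (both-ends⇒≈ᵉ e f p (endOf-resp g f (≈ᵉ-sym {f} {g} f≈g) q)))

  leaf-injective : ∀ {v e f} → f ∈ edges → IsLeafOf v e → IsLeafOf v f → e ≈ᵉ f
  leaf-injective {f = f} f∈B (_ , only-e) (v∈f , _) = only-e f f∈B v∈f

  -- The edge `vw` would join `e` to `f`. It is neither of them: were it `e`, then `e` would contain
  -- `w`, whose only edge in the set is `f`; symmetrically for `f`.
  leaves-nonadjacent : ∀ {v w e f} → e ∈ edges → f ∈ edges → ¬ (e ≈ᵉ f) →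
                       IsLeafOf v e → IsLeafOf w f → ¬ (v ~ w)
  leaves-nonadjacent {v} {w} {e} {f} e∈B f∈B e≉f (v∈e , only-e) (w∈f , only-f) v~w =
    eop e f e∈B f∈B e≉f (vw
      , (λ vw≈e → e≉f (≈ᵉ-sym {f} {e} (only-f e e∈B (endOf-resp vw e vw≈e (inj₂ refl)))))
      , (λ vw≈f → e≉f (only-e f f∈B (endOf-resp vw f vw≈f (inj₁ refl))))
      , inj₁ (v∈e , w∈f))
    where
    vw : Edge G
    vw = edge v w v~w

-- Upper bound for prisms

≢⇒≡opposite : {a b : Fin 2} → a ≢ b → b ≡ opposite a
≢⇒≡opposite {0F} {0F} a≢b = contradiction refl a≢b
≢⇒≡opposite {0F} {1F} _   = refl
≢⇒≡opposite {1F} {0F} _   = refl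
≢⇒≡opposite {1F} {1F} a≢b = contradiction refl a≢b

-- Each edge is sent to the base coordinate of its chosen leaf. Two leaves over the same base vertex
-- coincide or are adjacent; a common leaf determines its edge, and leaves of distinct edges are not
-- adjacent.
eop-prism-≤ : (G : Graph) (B : EdgeSet (G □ complete 2)) →
              IsEOP (G □ complete 2) B → ∣ G □ complete 2 ∣ᵉ B ≤ Graph.order G
eop-prism-≤ G B eop = injective⇒≤ {f = index} index-injective
  where
  open EdgeSet B
  open Leaves B eop
  open Graph (G □ complete 2) using (Vertex)
  S = edgeSetoid (G □ complete 2)
  open Membership S using (_∈_)
  ∈B : ∀ i → lookup edges i ∈ edges
  ∈B = Membershipₚ.∈-lookup S edges
  leafᵢ : Fin (length edges) → Vertex
  leafᵢ i = proj₁ (leaf (lookup edges i) (∈B i))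
  leafᵢ-isLeaf : ∀ i → IsLeafOf (leafᵢ i) (lookup edges i)
  leafᵢ-isLeaf i = proj₂ (leaf (lookup edges i) (∈B i))
  index : Fin (length edges) → Fin (Graph.order G)
  index i = Inverse.to (Graph.finite G) (proj₁ (leafᵢ i))
  same-fibre : ∀ {v w e f} → e ∈ edges → f ∈ edges → IsLeafOf v e → IsLeafOf w f →
               proj₁ v ≡ proj₁ w → e ≈ᵉ f
  same-fibre {x , a} {_ , b} {e} {f} e∈B f∈B v-leaf w-leaf refl with e ≈ᵉ? f
  ... | yes e≈f = e≈f
  ... | no  e≉f with a ≟ b
  ...   | yes refl = leaf-injective f∈B v-leaf w-leaf
  ...   | no  a≢b  = contradiction (inj₂ (refl , a≢b))
                       (leaves-nonadjacent e∈B f∈B e≉f v-leaf w-leaf)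
  index-injective : ∀ {i j} → index i ≡ index j → i ≡ j
  index-injective {i} {j} p = lookup-injective S unique i j
    (same-fibre (∈B i) (∈B j) (leafᵢ-isLeaf i) (leafᵢ-isLeaf j)
      (Injection.injective (Inverse⇒Injection (Graph.finite G)) p))

-- EOP sets made of stars

module _ (G : Graph) where
  open Graph G

  -- Indexing is by leaves, so `center` may take the same value repeatedly and `m` counts edges
  -- rather than stars.
  module Stars {m : ℕ} (leaf center : Fin m → Vertex)
    (leaf~center         : ∀ i → leaf i ~ center i)
    (leaf-injective      : ∀ {i j} → leaf i ≡ leaf j → i ≡ j)
    (leaves-independent  : ∀ {i j} → ¬ (leaf i ~ leaf j))
    (centers-independent : ∀ {i j} → ¬ (center i ~ center j))
    (center-unique       : ∀ {i j} → leaf i ~ center j → center j ≡ center i)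
    where
    open Edge
    open Setoid (edgeSetoid G) using () renaming (sym to ≈ᵉ-sym; trans to ≈ᵉ-trans)

    star-edge : Fin m → Edge G
    star-edge i = edge (leaf i) (center i) (leaf~center i)

    -- Otherwise `leaf j`, being adjacent to `center j`, would be adjacent to `leaf i`.
    leaf≢center : ∀ {i j} → leaf i ≢ center j
    leaf≢center {i} {j} p = leaves-independent (subst (leaf j ~_) (sym p) (leaf~center j))

    star-edge-injective : ∀ i j → star-edge i ≈ᵉ star-edge j → i ≡ j
    star-edge-injective i j (inj₁ (p , _)) = leaf-injective p
    star-edge-injective i j (inj₂ (p , _)) = contradiction p leaf≢center

    edges : EdgeSet G
    edges = record
      { edges  = tabulate star-edge
      ; unique = tabulate⁺ (edgeSetoid G) λ {i} {j} → star-edge-injective i j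
      }

    -- Independence leaves only edges from a leaf to a center, and `center-unique` makes such an
    -- edge the star edge of its own leaf.
    joining-edge : ∀ e i j → end₁ e endOf star-edge i → end₂ e endOf star-edge j →
                   e ≈ᵉ star-edge i ⊎ e ≈ᵉ star-edge j
    joining-edge (edge _ _ a) i j (inj₁ refl) (inj₁ refl) = contradiction a leaves-independent
    joining-edge (edge _ _ a) i j (inj₁ refl) (inj₂ refl) = inj₁ (inj₁ (refl , center-unique a))
    joining-edge (edge _ _ a) i j (inj₂ refl) (inj₁ refl) =
      inj₂ (inj₂ (center-unique (~-sym a) , refl))
    joining-edge (edge _ _ a) i j (inj₂ refl) (inj₂ refl) = contradiction a centers-independent

    edges-EOP : IsEOP G edges
    edges-EOP e₁ e₂ e₁∈ e₂∈ _ (e , e≉e₁ , e≉e₂ , joins)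
      with i , e₁≈ ← Membershipₚ.∈-tabulate⁻ (edgeSetoid G) {f = star-edge} {e₁} e₁∈
         | j , e₂≈ ← Membershipₚ.∈-tabulate⁻ (edgeSetoid G) {f = star-edge} {e₂} e₂∈ =
      absurd joins
      where
      e≉i : ¬ (e ≈ᵉ star-edge i)
      e≉i p = e≉e₁ (≈ᵉ-trans {e} {star-edge i} {e₁} p (≈ᵉ-sym {e₁} {star-edge i} e₁≈))
      e≉j : ¬ (e ≈ᵉ star-edge j)
      e≉j p = e≉e₂ (≈ᵉ-trans {e} {star-edge j} {e₂} p (≈ᵉ-sym {e₂} {star-edge j} e₂≈))
      to-i : ∀ {v} → v endOf e₁ → v endOf star-edge i
      to-i = endOf-resp e₁ (star-edge i) e₁≈
      to-j : ∀ {v} → v endOf e₂ → v endOf star-edge j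
      to-j = endOf-resp e₂ (star-edge j) e₂≈
      absurd : ¬ Joins e e₁ e₂
      absurd (inj₁ (p , q)) = [ e≉i , e≉j ]′ (joining-edge e i j (to-i p) (to-j q))
      absurd (inj₂ (p , q)) = [ e≉j , e≉i ]′ (joining-edge e j i (to-j q) (to-i p))

    ∣edges∣ : ∣ G ∣ᵉ edges ≡ m
    ∣edges∣ = length-tabulate star-edge

-- Adjacency in the hypercube as flipping a coordinate

-- Cube n is the vertex set of Q (suc n); coordinate zero is the last K₂ factor.
module _ (n : ℕ) where
  open Graph (Q (suc n)) public using () renaming (Vertex to Cube)

toggle : ∀ {n} → Fin (suc n) → Cube n → Cube n
toggle {zero}  _       b       = opposite b
toggle {suc n} zero    (v , b) = v , opposite b
toggle {suc n} (suc i) (v , b) = toggle i v , b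

≢opposite : (b : Fin 2) → b ≢ opposite b
≢opposite 0F ()
≢opposite 1F ()

~-toggle : ∀ {n} (i : Fin (suc n)) (v : Cube n) → Graph._~_ (Q (suc n)) v (toggle i v)
~-toggle {zero}  _       b       = ≢opposite b
~-toggle {suc n} zero    (v , b) = inj₂ (refl , ≢opposite b)
~-toggle {suc n} (suc i) (v , b) = inj₁ (~-toggle {n} i v , refl)

~⇒toggle : ∀ {n} (v w : Cube n) → Graph._~_ (Q (suc n)) v w → ∃[ i ] w ≡ toggle {n} i v
~⇒toggle {zero}  _       _       v~w                = zero , ≢⇒≡opposite v~w
~⇒toggle {suc n} _       _       (inj₂ (refl , b≢)) = zero , cong (_ ,_) (≢⇒≡opposite b≢)
~⇒toggle {suc n} (v , _) (w , _) (inj₁ (v~w , refl)) with i , refl ← ~⇒toggle {n} v w v~w =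
  suc i , refl

-- Linear algebra over 𝔽₂ and syndromes

module _ {k : ℕ} where

  infixr 6 _⊕_

  _⊕_ : (x y : Vec Bool k) → Vec Bool k
  _⊕_ = zipWith _xor_

  𝟎 : Vec Bool k
  𝟎 = replicate k false

⊕-identityʳ : ∀ {k} (x : Vec Bool k) → x ⊕ 𝟎 ≡ x
⊕-identityʳ = zipWith-identityʳ xor-identityʳ

⊕-cancel : ∀ {k} (x y : Vec Bool k) → x ⊕ x ⊕ y ≡ y
⊕-cancel []          []      = refl
⊕-cancel (false ∷ x) (b ∷ y) = cong (b ∷_) (⊕-cancel x y)
⊕-cancel (true  ∷ x) (b ∷ y) = cong₂ _∷_ (not-involutive b) (⊕-cancel x y)

⊕-swap : ∀ {k} (x y z : Vec Bool k) → x ⊕ y ⊕ z ≡ y ⊕ x ⊕ z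
⊕-swap x y z = begin
  x ⊕ y ⊕ z    ≡⟨ zipWith-assoc xor-assoc x y z ⟨
  (x ⊕ y) ⊕ z  ≡⟨ cong (_⊕ z) (zipWith-comm xor-comm x y) ⟩
  (y ⊕ x) ⊕ z  ≡⟨ zipWith-assoc xor-assoc y x z ⟩
  y ⊕ x ⊕ z    ∎
  where open ≡-Reasoning

module _ {k : ℕ} where

  -- This is `b · a + x`, with the coordinate `b` read as a scalar of 𝔽₂.
  add : Fin 2 → (a x : Vec Bool k) → Vec Bool k
  add 0F a x = x
  add 1F a x = a ⊕ x

  add-opposite : ∀ b a x → add (opposite b) a x ≡ a ⊕ add b a x
  add-opposite 0F a x = refl
  add-opposite 1F a x = sym (⊕-cancel a x)

  add-⊕ : ∀ b a c x → add b a (c ⊕ x) ≡ c ⊕ add b a x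
  add-⊕ 0F a c x = refl
  add-⊕ 1F a c x = ⊕-swap a c x

  -- The product of the matrix with columns h i and the vector v.
  syndrome : ∀ {n} → (Fin (suc n) → Vec Bool k) → Cube n → Vec Bool k
  syndrome {zero}  h b       = add b (h zero) 𝟎
  syndrome {suc n} h (v , b) = add b (h zero) (syndrome (h ∘ suc) v)

  -- Linearity: flipping bit `i` changes the argument by a unit vector. In the recursive case the
  -- new column is moved outward past the later summand by `add-⊕`.
  syndrome-toggle : ∀ {n} (h : Fin (suc n) → Vec Bool k) i v →
                    syndrome h (toggle i v) ≡ h i ⊕ syndrome h v
  syndrome-toggle {zero}  h zero    b       = add-opposite b (h zero) 𝟎
  syndrome-toggle {suc n} h zero    (v , b) = add-opposite b (h zero) (syndrome (h ∘ suc) v)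
  syndrome-toggle {suc n} h (suc i) (v , b) =
    trans (cong (add b (h zero)) (syndrome-toggle (h ∘ suc) i v))
          (add-⊕ b (h zero) (h (suc i)) (syndrome (h ∘ suc) v))

-- The extended Hamming code

module ExtendedHamming {n k : ℕ} (bits : Fin (suc n) ↔ Vec Bool k) where
  open Graph (Q (suc n))
  open Inverse bits using (to; from; strictlyInverseˡ; strictlyInverseʳ)

  -- As `bits` is a bijection, every vector with first bit 1 is a column exactly once: surjectivity
  -- gives an odd vertex a neighbour in the code, injectivity makes it unique.
  column : Fin (suc n) → Vec Bool (suc k)
  column i = true ∷ to i

  syn : Vertex → Vec Bool (suc k)
  syn = syndrome column

  -- All columns start with 1, so the first bit of the syndrome is the weight mod 2.
  parity : Vertex → Bool
  parity v = head (syn v)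

  parity-toggle : ∀ i v → parity (toggle i v) ≡ not (parity v)
  parity-toggle i v rewrite syndrome-toggle column i v with _ ∷ _ ← syn v = refl

  -- The bipartition of the cube: it yields independence both of the odd leaves and of the even
  -- codewords.
  ~⇒parity≢ : ∀ v w → v ~ w → parity v ≢ parity w
  ~⇒parity≢ v w v~w p with i , refl ← ~⇒toggle {n} v w v~w = not-¬ (sym p) (parity-toggle i v)

  -- Syndrome decoding of a single error. The function is total, but its value is a codeword only
  -- for odd `v`, when `syn v` is itself a column.
  center : Vertex → Vertex
  center v = toggle (from (tail (syn v))) v

  ~-center : ∀ v → v ~ center v
  ~-center v = ~-toggle {n} (from (tail (syn v))) v

  syn-center : ∀ v → parity v ≡ true → syn (center v) ≡ 𝟎
  syn-center v odd = begin
    syn (center v)                         ≡⟨ syndrome-toggle column _ v ⟩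
    column (from (tail (syn v))) ⊕ syn v   ≡⟨ cong (_⊕ syn v) (column-odd (syn v) odd) ⟩
    -- The zero vector is appended to reach the shape of `⊕-cancel`.
    syn v ⊕ syn v                          ≡⟨ cong (syn v ⊕_) (⊕-identityʳ (syn v)) ⟨
    syn v ⊕ syn v ⊕ 𝟎                      ≡⟨ ⊕-cancel (syn v) 𝟎 ⟩
    𝟎                                      ∎
    where
    open ≡-Reasoning
    column-odd : ∀ x → head x ≡ true → column (from (tail x)) ≡ x
    column-odd (_ ∷ x) refl = cong (true ∷_) (strictlyInverseˡ x)

  -- If flipping bit `i` of `v` gives syndrome zero, then `syn v` equals column `i`, whose tail
  -- determines `i`.
  center-unique : ∀ v w → v ~ w → syn w ≡ 𝟎 → w ≡ center v
  center-unique v w v~w w∈code with i , refl ← ~⇒toggle {n} v w v~w =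
    cong (λ j → toggle j v) (sym (trans (cong (from ∘ tail) syn≡column) (strictlyInverseʳ i)))
    where
    open ≡-Reasoning
    syn≡column : syn v ≡ column i
    syn≡column = begin
      syn v                         ≡⟨ ⊕-cancel (column i) (syn v) ⟨
      column i ⊕ column i ⊕ syn v   ≡⟨ cong (column i ⊕_) (syndrome-toggle column i v) ⟨
      column i ⊕ syn (toggle i v)   ≡⟨ cong (column i ⊕_) w∈code ⟩
      column i ⊕ 𝟎                  ≡⟨ ⊕-identityʳ (column i) ⟩
      column i                      ∎

-- Lower bound and conclusion

order-Q : ∀ n → Graph.order (Q (suc n)) ≡ 2 ^ suc n
order-Q zero    = refl
order-Q (suc n) = trans (*-comm (Graph.order (Q (suc n))) 2) (cong (2 *_) (order-Q n))

-- The leaves are the odd vertices. Dropping the last coordinate matches them with the vertices of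
-- `Q (suc n)`, which gives the count.
hypercube-EOP : ∀ {n k} → Fin (2 + n) ↔ Vec Bool k →
                ∃[ B ] (IsEOP (Q (2 + n)) B × ∣ Q (2 + n) ∣ᵉ B ≡ Graph.order (Q (suc n)))
hypercube-EOP {n} bits = edges , edges-EOP , ∣edges∣
  where
  open ExtendedHamming bits
  open Graph (Q (suc n)) using (finite)
  open Graph (Q (2 + n)) using (_~_)

  -- The last coordinate serves as a parity bit: if 0 gives even weight, flipping it gives odd
  -- weight.
  odd-extension : (u : Cube n) → ∃[ b ] parity (u , b) ≡ true
  odd-extension u with parity (u , 0F) in p
  ... | true  = 0F , p
  ... | false = 1F , trans (parity-toggle zero (u , 0F)) (cong not p)

  prefix : Fin (Graph.order (Q (suc n))) → Cube n
  prefix = Inverse.from finite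

  leaf : Fin (Graph.order (Q (suc n))) → Cube (suc n)
  leaf i = prefix i , proj₁ (odd-extension (prefix i))

  leaf-odd : ∀ i → parity (leaf i) ≡ true
  leaf-odd i = proj₂ (odd-extension (prefix i))

  center-code : ∀ i → syn (center (leaf i)) ≡ 𝟎
  center-code i = syn-center (leaf i) (leaf-odd i)

  leaf-injective : ∀ {i j} → leaf i ≡ leaf j → i ≡ j
  leaf-injective p = Injection.injective (Inverse⇒Injection (↔-sym finite)) (cong proj₁ p)

  leaves-independent : ∀ {i j} → ¬ (leaf i ~ leaf j)
  leaves-independent {i} {j} a =
    ~⇒parity≢ (leaf i) (leaf j) a (trans (leaf-odd i) (sym (leaf-odd j)))

  centers-independent : ∀ {i j} → ¬ (center (leaf i) ~ center (leaf j))
  centers-independent {i} {j} a = ~⇒parity≢ (center (leaf i)) (center (leaf j)) a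
    (cong head (trans (center-code i) (sym (center-code j))))

  same-center : ∀ {i j} → leaf i ~ center (leaf j) → center (leaf j) ≡ center (leaf i)
  same-center {i} {j} a = center-unique (leaf i) (center (leaf j)) a (center-code j)

  open Stars (Q (2 + n)) leaf (center ∘ leaf) (~-center ∘ leaf) leaf-injective
    leaves-independent centers-independent same-center

Fin[2^k]↔Vec-Bool : ∀ k → Fin (2 ^ k) ↔ Vec Bool k
Fin[2^k]↔Vec-Bool k = ↔-trans (Rec.Fin[m^n]↔Fin[m]^n 2 k) (↔-trans (Rec.lift↔ k 2↔Bool) (↔Vec k))

theorem5p10 : (n k : ℕ) .{{_ : NonZero n}} → k ≥ 1 → n ≡ 2 ^ k →
    IsEOPNumber (Q n) (2 ^ (n ∸ 1))
theorem5p10 zero          k       _ n≡2^k = contradiction (m^n≡0⇒m≡0 2 k (sym n≡2^k)) λ()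
-- Here `k ≥ 1` makes the power a multiple of 2, hence different from 1.
theorem5p10 (suc zero)    (suc k) _ n≡2^k = contradiction (m*n≡1⇒m≡1 2 (2 ^ k) (sym n≡2^k)) λ()
theorem5p10 (suc (suc n)) k       _ n≡2^k =
  -- `Q (2 + n)` is by definition the prism over `Q (suc n)`, so both bounds equal the order of the
  -- latter.
  subst (IsEOPNumber (Q (2 + n))) (order-Q n)
    ( hypercube-EOP (subst (λ m → Fin m ↔ Vec Bool k) (sym n≡2^k) (Fin[2^k]↔Vec-Bool k))
    , eop-prism-≤ (Q (suc n)))
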